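{- $\mathrm{WL}_1\not\preceq\omega^{(3)}$: there exist graphs $G$ and $H$ with $\omega^{(3)}(G)=\omega^{(3)}(H)$ but $\mathrm{WL}_1(G)\ne\mathrm{WL}_1(H)$.
   Context: Graphs are finite, simple and undirected; an $N$-vertex graph has $V(G)=\{1,\dots,N\}$. Let $w_k(x,y)$ be the number of walks of length $k$ from $x$ to $y$, $w_*(x,y)=(w_0(x,y),\dots,w_{N-1}(x,y))$. Define $\omega_0(x)=w_*(x,x)$, $\omega_{r+1}(x)=\big(\omega_r(x),\{\!\{(w_*(x,y),\omega_r(y))\}\!\}_{y\in V(G)}\big)$, where $\{\!\{\cdot\}\!\}$ denotes a multiset, and $\omega^{(r)}(G)=\{\!\{\omega_r(x)\}\!\}_{x\in V(G)}$. Color refinement: $C^0(x)$ uniform, $C^{r+1}(x)=\big(C^r(x),\{\!\{C^r(y)\}\!\}_{y\in N(x)}\big)$; $\mathrm{WL}_1(G)=\{\!\{C^N(x)\}\!\}_{x\in V(G)}$. -}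

module Defs where

open import Axiom.UniquenessOfIdentityProofs using (module Decidable⇒UIP)
open import Data.Bool using (Bool; true; false; T; if_then_else_)
open import Data.Bool.Properties using (T-irrelevant)
open import Data.Empty using (⊥-elim)
open import Data.Fin using (Fin; zero; suc; _≟_)
open import Data.Fin.Properties using (+↔⊎)
open import Data.List using (List; map; filterᵇ; tabulate; allFin; upTo)
import Data.List.Relation.Binary.Permutation.Homogeneous as Homogeneous
open import Data.List.Relation.Binary.Permutation.Setoid using (↭-setoid)
open import Data.Nat using (ℕ; zero; suc)
open import Data.Nat.ListAction using (sum)
open import Data.Product using (∃-syntax; _×_; _,_)
open import Data.Product.Relation.Binary.Pointwise.NonDependent using (×-setoid)
open import Data.Sum using (_⊎_; inj₁; inj₂)
open import Data.Sum.Function.Propositional using (_⊎-↔_)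
open import Data.Unit using (tt)
open import Function using (_∘_; _↔_; mk↔ₛ′)
open import Function.Properties.Inverse using (↔-sym; ↔-trans)
open import Level using (0ℓ)
open import Relation.Binary using (Setoid)
open import Relation.Binary.PropositionalEquality
  using (_≡_; refl; sym; cong; subst; setoid)
open import Relation.Nullary using (does; yes; no)

record Graph : Set where
  field
    order      : ℕ
    adjacent   : Fin order → Fin order → Bool
    symmetric  : ∀ x y → adjacent x y ≡ adjacent y x
    loopless   : ∀ x → adjacent x x ≡ false

  Vertex : Set
  Vertex = Fin order

  vertices : List Vertex
  vertices = allFin order

  neighbours : Vertex → List Vertex
  neighbours x = filterᵇ (adjacent x) vertices

open Graph using (order; vertices; neighbours; adjacent)
open Graph public using (Vertex)

-- Multisets are lists compared up to permutation, with entries compared in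
-- the given setoid (so nested multisets are compared correctly).
Multiset : Setoid 0ℓ 0ℓ → Setoid 0ℓ 0ℓ
Multiset S = ↭-setoid S

data Walk (G : Graph) : ℕ → Vertex G → Vertex G → Set where
  stay : ∀ {x} → Walk G 0 x x
  step : ∀ {k x y} z → T (adjacent G x z) → Walk G k z y → Walk G (suc k) x y

-- The number of walks of length k from x to y; Walk↔Fin below shows that this
-- recursion counts the inhabitants of Walk G k x y.
w : (G : Graph) → ℕ → Vertex G → Vertex G → ℕ
w G zero    x y = if does (x ≟ y) then 1 else 0
w G (suc k) x y = sum (map (λ z → w G k z y) (neighbours G x))

private
  Σ↔Fin-sum : ∀ {A : Set} (p : A → Bool) {B : A → Set} (f : A → ℕ) →
              (∀ a → B a ↔ Fin (f a)) → ∀ {n} (g : Fin n → A) →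
              (∃[ i ] T (p (g i)) × B (g i)) ↔
              Fin (sum (map f (filterᵇ p (tabulate g))))
  Σ↔Fin-sum p f B↔ {zero} g =
    mk↔ₛ′ (λ { (() , _) }) (λ ()) (λ ()) (λ { (() , _) })
  Σ↔Fin-sum p {B} f B↔ {suc n} g
    with p (g zero) in eq | Σ↔Fin-sum p f B↔ (g ∘ suc)
  ... | true  | rec =
    ↔-trans (mk↔ₛ′ to from to-from from-to)
            (↔-trans (B↔ (g zero) ⊎-↔ rec) (↔-sym +↔⊎))
    where
    Tail : Set
    Tail = ∃[ i ] T (p (g (suc i))) × B (g (suc i))

    t₀ : T (p (g zero))
    t₀ = subst T (sym eq) tt

    to : (∃[ i ] T (p (g i)) × B (g i)) → B (g zero) ⊎ Tail
    to (zero  , _ , b) = inj₁ b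
    to (suc i , t , b) = inj₂ (i , t , b)

    from : B (g zero) ⊎ Tail → ∃[ i ] T (p (g i)) × B (g i)
    from (inj₁ b)           = zero , t₀ , b
    from (inj₂ (i , t , b)) = suc i , t , b

    to-from : ∀ s → to (from s) ≡ s
    to-from (inj₁ _) = refl
    to-from (inj₂ _) = refl

    from-to : ∀ s → from (to s) ≡ s
    from-to (zero  , t , b) = cong (λ s → zero , s , b) (T-irrelevant t₀ t)
    from-to (suc _ , _ , _) = refl
  ... | false | rec = ↔-trans (mk↔ₛ′ to from (λ _ → refl) from-to) rec
    where
    to : (∃[ i ] T (p (g i)) × B (g i)) → ∃[ i ] T (p (g (suc i))) × B (g (suc i))
    to (zero  , t , _) = ⊥-elim (subst T eq t)
    to (suc i , t , b) = i , t , b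

    from : (∃[ i ] T (p (g (suc i))) × B (g (suc i))) → ∃[ i ] T (p (g i)) × B (g i)
    from (i , t , b) = suc i , t , b

    from-to : ∀ s → from (to s) ≡ s
    from-to (zero  , t , _) = ⊥-elim (subst T eq t)
    from-to (suc _ , _ , _) = refl

  Walk-zero : ∀ {G x y} → Walk G 0 x y ↔ (x ≡ y)
  Walk-zero = mk↔ₛ′ (λ { stay → refl }) (λ { refl → stay })
                    (λ { refl → refl }) (λ { stay → refl })

  Walk-suc : ∀ {G k x y} →
             Walk G (suc k) x y ↔ (∃[ z ] T (adjacent G x z) × Walk G k z y)
  Walk-suc = mk↔ₛ′ (λ { (step z a p) → z , a , p }) (λ { (z , a , p) → step z a p })
                   (λ _ → refl) (λ { (step _ _ _) → refl })

Walk↔Fin : ∀ G k x y → Walk G k x y ↔ Fin (w G k x y)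
Walk↔Fin G zero x y with x ≟ y
... | yes x≡y = ↔-trans Walk-zero
                  (mk↔ₛ′ (λ _ → zero) (λ _ → x≡y)
                         (λ { zero → refl }) (λ _ → Decidable⇒UIP.≡-irrelevant _≟_ _ _))
... | no  x≢y = ↔-trans Walk-zero
                  (mk↔ₛ′ (λ x≡y → ⊥-elim (x≢y x≡y)) (λ ()) (λ ())
                         (λ x≡y → ⊥-elim (x≢y x≡y)))
Walk↔Fin G (suc k) x y =
  ↔-trans Walk-suc
          (Σ↔Fin-sum (adjacent G x) (λ z → w G k z y) (λ z → Walk↔Fin G k z y) (λ z → z))

-- A list rather than a vector, so that colours of graphs of different orders
-- have the same type; tuples of different lengths are then unequal.
w⋆ : (G : Graph) → Vertex G → Vertex G → List ℕ
w⋆ G x y = map (λ k → w G k x y) (upTo (order G))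

ωColour : ℕ → Setoid 0ℓ 0ℓ
ωColour zero    = setoid (List ℕ)
ωColour (suc r) = ×-setoid (ωColour r) (Multiset (×-setoid (setoid (List ℕ)) (ωColour r)))

ω : (G : Graph) (r : ℕ) → Vertex G → Setoid.Carrier (ωColour r)
ω G zero    x = w⋆ G x x
ω G (suc r) x = ω G r x , map (λ y → w⋆ G x y , ω G r y) (vertices G)

ω⟨_⟩ : (r : ℕ) → Graph → Setoid.Carrier (Multiset (ωColour r))
ω⟨ r ⟩ G = map (ω G r) (vertices G)

infix 4 _≈ω⟨_⟩_ _≈ᶜ_ _≈WL₁_

_≈ω⟨_⟩_ : Graph → ℕ → Graph → Set
G ≈ω⟨ r ⟩ H = Setoid._≈_ (Multiset (ωColour r)) (ω⟨ r ⟩ G) (ω⟨ r ⟩ H)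

-- One type for the colours of all rounds: the number of rounds in WL₁ is the
-- order of the graph, and graphs of different orders must be comparable.
-- The list in refine is a multiset, as reflected in _≈ᶜ_.
data Colour : Set where
  uniform : Colour
  refine  : Colour → List Colour → Colour

data _≈ᶜ_ : Colour → Colour → Set where
  uniform : uniform ≈ᶜ uniform
  refine  : ∀ {c d cs ds} → c ≈ᶜ d → Homogeneous.Permutation _≈ᶜ_ cs ds →
            refine c cs ≈ᶜ refine d ds

C : (G : Graph) → ℕ → Vertex G → Colour
C G zero    x = uniform
C G (suc r) x = refine (C G r x) (map (C G r) (neighbours G x))

WL₁ : Graph → List Colour
WL₁ G = map (C G (order G)) (vertices G)

_≈WL₁_ : Graph → Graph → Set
G ≈WL₁ H = Homogeneous.Permutation _≈ᶜ_ (WL₁ G) (WL₁ H)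

{-# OPTIONS --safe #-}

-- Let L be the graph of the 28 pairs from {0,…,7}, adjacent when they share one
-- element; it is strongly regular, with A² = 8I + 2A + 4J.  For a set S of pairs,
-- add an apex joined to the members of S.  The new adjacency matrix B satisfies
-- B² = 8I + 2B + (a bilinear form in a few vertex functions, the labels), and the
-- span of the labels is invariant under B.  Hence w⋆ x y depends only on whether
-- x and y are equal or adjacent and on the labels of x and y, and ω gains nothing
-- over colour refinement of L with S marked.
--
-- For S take the edges of a graph on {0,…,7}: in both graphs
-- 0 – 1,2;  1,2 – 3;  3 – 4,5;  4,5 – 6,7;  6 – 7, and in addition
-- 1 – 4,5 and 2 – 6,7 in the first, 1 – 4,6 and 2 – 5,7 in the second.
-- Colour refinement needs six rounds to tell these apart.

module Submission where

open import Defs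
open import Data.Bool using (Bool; true; false; if_then_else_; _xor_)
import Data.Bool.Properties as Bool
open import Data.Fin using (Fin; zero; suc; toℕ; #_; _≤?_)
open import Data.Fin.Properties using (all?; toℕ-injective)
import Data.Fin.Properties as Fin
open import Data.List using (List; []; _∷_; map; upTo; allFin; filterᵇ; length; foldr; foldl)
import Data.List as List
open import Data.List.Properties using (map-cong; map-∘; ≡-dec; ∷-injective)
open import Data.List.Relation.Binary.Permutation.Homogeneous as Homogeneous using (Permutation)
open import Data.List.Relation.Binary.Permutation.Propositional
  using (_↭_; ↭-sym; ↭-trans; ↭-reflexive; ↭⇒↭ₛ)
open import Data.List.Relation.Binary.Permutation.Propositional.Properties using (↭-map-inv; map⁺)
open import Data.List.Relation.Binary.Pointwise using (Pointwise; []; _∷_)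
open import Data.List.Sort.InsertionSort.Base using (sort)
open import Data.List.Sort.InsertionSort.Properties using (sort-↭)
open import Data.Nat using (ℕ; zero; suc; _+_; _*_; _≡ᵇ_; _<ᵇ_)
open import Data.Nat.ListAction using (sum)
import Data.Nat.Properties as ℕ
open import Data.Nat.Tactic.RingSolver using (solve-∀)
open import Data.Product using (_×_; Σ-syntax; _,_; proj₁; proj₂)
import Data.Product.Properties as Product
open import Data.Product.Relation.Binary.Lex.NonStrict using (×-decTotalOrder)
open import Data.Vec using (Vec; []; _∷_; lookup; tabulate; zipWith; replicate; _++_)
import Data.Vec as Vec
import Data.Vec.Properties as Vec
open import Function using (_∘_)
open import Level using (0ℓ)
open import Relation.Binary using (Setoid; DecTotalOrder)
open import Relation.Binary.PropositionalEquality
open import Relation.Nullary using (¬_; from-yes; from-no; does)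

open Graph using (order; vertices; neighbours; adjacent)

private
  variable
    n m : ℕ

-- Linear algebra over ℕ.

infixl 6 _⊕_
infixl 7 _·_ _⊛_

_⊕_ : Vec ℕ n → Vec ℕ n → Vec ℕ n
_⊕_ = zipWith _+_

𝟎 : Vec ℕ n
𝟎 = replicate _ 0

_·_ : Vec ℕ n → Vec ℕ n → ℕ
[]       · []       = 0
(a ∷ as) · (b ∷ bs) = a * b + as · bs

_⊛_ : Vec (Vec ℕ n) m → Vec ℕ n → Vec ℕ m
M ⊛ u = Vec.map (_· u) M

·-distribˡ-⊕ : (a u v : Vec ℕ n) → a · (u ⊕ v) ≡ a · u + a · v
·-distribˡ-⊕ []       []       []       = refl
·-distribˡ-⊕ (a ∷ as) (u ∷ us) (v ∷ vs) =
  trans (cong (a * (u + v) +_) (·-distribˡ-⊕ as us vs)) (regroup a u v (as · us) (as · vs))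
  where
  regroup : ∀ a u v s t → a * (u + v) + (s + t) ≡ a * u + s + (a * v + t)
  regroup = solve-∀

·-zeroʳ : (a : Vec ℕ n) → a · 𝟎 ≡ 0
·-zeroʳ []       = refl
·-zeroʳ (a ∷ as) = trans (cong (_+ as · 𝟎) (ℕ.*-zeroʳ a)) (·-zeroʳ as)

⊛-distribˡ-⊕ : (M : Vec (Vec ℕ n) m) (u v : Vec ℕ n) → M ⊛ (u ⊕ v) ≡ M ⊛ u ⊕ M ⊛ v
⊛-distribˡ-⊕ []      u v = refl
⊛-distribˡ-⊕ (a ∷ M) u v = cong₂ _∷_ (·-distribˡ-⊕ a u v) (⊛-distribˡ-⊕ M u v)

⊛-zeroʳ : (M : Vec (Vec ℕ n) m) → M ⊛ 𝟎 ≡ 𝟎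
⊛-zeroʳ []      = refl
⊛-zeroʳ (a ∷ M) = cong₂ _∷_ (·-zeroʳ a) (⊛-zeroʳ M)

total : List (Vec ℕ n) → Vec ℕ n
total = foldr _⊕_ 𝟎

sum-linear : ∀ {A : Set} (a b : ℕ) (f g h : A → ℕ) xs →
             sum (map (λ x → a * f x + b * g x + h x) xs) ≡
             a * sum (map f xs) + b * sum (map g xs) + sum (map h xs)
sum-linear a b f g h []       = base a b
  where
  base : ∀ a b → 0 ≡ a * 0 + b * 0 + 0
  base = solve-∀
sum-linear a b f g h (x ∷ xs) =
  trans (cong (a * f x + b * g x + h x +_) (sum-linear a b f g h xs))
        (regroup a b (f x) (g x) (h x) _ _ _)
  where
  regroup : ∀ a b f g h F G H → a * f + b * g + h + (a * F + b * G + H) ≡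
                                a * (f + F) + b * (g + G) + (h + H)
  regroup = solve-∀

-- Walks of all lengths from those of length at most two.

module WalkFormula {d : ℕ} (a b : ℕ) (K T : Vec (Vec ℕ d) d) where

  -- Coefficients in `B^k = α_k I + β_k B + φ_k`, where `B²` is `a I + b B` plus a bilinear form in
  -- the labels.
  coefficients : ℕ → ℕ × ℕ
  coefficients zero    = 1 , 0
  coefficients (suc k) with coefficients k
  ... | α , β = a * β , α + b * β

  α β : ℕ → ℕ
  α k = proj₁ (coefficients k)
  β k = proj₂ (coefficients k)

  φ : ℕ → Vec ℕ d → Vec ℕ d → ℕ
  φ zero    l u = 0
  φ (suc k) l u = β k * ((K ⊛ l) · u) + φ k l (T ⊛ u)

  walks : ℕ → ℕ → Vec ℕ d → Vec ℕ d → ℕ → ℕ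
  walks i j l u k = α k * i + β k * j + φ k l u

  φ-⊕ : ∀ k l u v → φ k l (u ⊕ v) ≡ φ k l u + φ k l v
  φ-⊕ zero    l u v = refl
  φ-⊕ (suc k) l u v = begin
    β k * ((K ⊛ l) · (u ⊕ v)) + φ k l (T ⊛ (u ⊕ v))
      ≡⟨ cong₂ _+_ (cong (β k *_) (·-distribˡ-⊕ (K ⊛ l) u v))
                   (trans (cong (φ k l) (⊛-distribˡ-⊕ T u v)) (φ-⊕ k l (T ⊛ u) (T ⊛ v))) ⟩
    β k * ((K ⊛ l) · u + (K ⊛ l) · v) + (φ k l (T ⊛ u) + φ k l (T ⊛ v))
      ≡⟨ regroup (β k) _ _ _ _ ⟩
    φ (suc k) l u + φ (suc k) l v ∎
    where
    open ≡-Reasoning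
    regroup : ∀ b p q r s → b * (p + q) + (r + s) ≡ b * p + r + (b * q + s)
    regroup = solve-∀

  φ-𝟎 : ∀ k l → φ k l 𝟎 ≡ 0
  φ-𝟎 zero    l = refl
  φ-𝟎 (suc k) l = begin
    β k * ((K ⊛ l) · 𝟎) + φ k l (T ⊛ 𝟎)
      ≡⟨ cong₂ _+_ (trans (cong (β k *_) (·-zeroʳ (K ⊛ l))) (ℕ.*-zeroʳ (β k)))
                   (trans (cong (φ k l) (⊛-zeroʳ T)) (φ-𝟎 k l)) ⟩
    0 ∎
    where open ≡-Reasoning

  φ-total : ∀ k l us → sum (map (φ k l) us) ≡ φ k l (total us)
  φ-total k l []       = sym (φ-𝟎 k l)
  φ-total k l (u ∷ us) = trans (cong (φ k l u +_) (φ-total k l us)) (sym (φ-⊕ k l u (total us)))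

  module _ (X : Graph) (u : Vertex X → Vec ℕ d)
           (w₂ : ∀ x y → w X 2 x y ≡ a * w X 0 x y + b * w X 1 x y + (K ⊛ u y) · u x)
           (equitable : ∀ x → total (map u (neighbours X x)) ≡ T ⊛ u x) where

    -- Split off the first step: `w₂` reduces the walks of length two that arise, and additivity of
    -- `φ k l` lets `equitable` replace the sum over neighbours by `T`.
    w-formula : ∀ k x y → w X k x y ≡ walks (w X 0 x y) (w X 1 x y) (u y) (u x) k
    w-formula zero    x y = base (w X 0 x y) (w X 1 x y)
      where
      base : ∀ i j → i ≡ 1 * i + 0 * j + 0
      base = solve-∀
    w-formula (suc k) x y = begin
      sum (map (λ z → w X k z y) N)
        ≡⟨ cong sum (map-cong (λ z → w-formula k z y) N) ⟩
      sum (map (λ z → α k * w X 0 z y + β k * w X 1 z y + φ k (u y) (u z)) N)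
        ≡⟨ sum-linear (α k) (β k) (λ z → w X 0 z y) (λ z → w X 1 z y) (λ z → φ k (u y) (u z)) N ⟩
      -- The neighbour sums of `w X 0 z y` and `w X 1 z y` are these walk counts by definition.
      α k * w X 1 x y + β k * w X 2 x y + sum (map (λ z → φ k (u y) (u z)) N)
        ≡⟨ cong₂ (λ p q → α k * w X 1 x y + β k * p + q) (w₂ x y) φ-sum ⟩
      α k * w X 1 x y + β k * (a * w X 0 x y + b * w X 1 x y + (K ⊛ u y) · u x) + φ k (u y) (T ⊛ u x)
        ≡⟨ regroup a b (α k) (β k) (w X 0 x y) (w X 1 x y) _ _ ⟩
      walks (w X 0 x y) (w X 1 x y) (u y) (u x) (suc k) ∎
      where
      open ≡-Reasoning
      N = neighbours X x

      φ-sum : sum (map (λ z → φ k (u y) (u z)) N) ≡ φ k (u y) (T ⊛ u x)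
      φ-sum = begin
        sum (map (λ z → φ k (u y) (u z)) N)  ≡⟨ cong sum (map-∘ N) ⟩
        sum (map (φ k (u y)) (map u N))      ≡⟨ φ-total k (u y) (map u N) ⟩
        φ k (u y) (total (map u N))          ≡⟨ cong (φ k (u y)) (equitable x) ⟩
        φ k (u y) (T ⊛ u x)                  ∎

      regroup : ∀ a b α β i j p q →
                α * j + β * (a * i + b * j + p) + q ≡ a * β * i + (α + b * β) * j + (β * p + q)
      regroup = solve-∀

-- Permutations and indicator sums.

-- Inverting the permutation rearranges `xs` so that its values under `f` agree position by position
-- with those of `ys` under `g`.
↭-map : ∀ {A B E S : Set} {R : S → S → Set} (R-refl : ∀ {s} → R s s)
        {f : A → E} {g : B → E} {p : A → S} {q : B → S} →
        (∀ x y → f x ≡ g y → R (p x) (q y)) →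
        ∀ xs ys → map f xs ↭ map g ys → Permutation R (map p xs) (map q ys)
↭-map {R = R} R-refl {f} {g} {p} {q} fg⇒R xs ys fxs↭gys with ↭-map-inv f fxs↭gys
... | zs , gys≡fzs , xs↭zs =
  Homogeneous.trans
    (Homogeneous.map (λ { refl → R-refl }) (↭⇒↭ₛ (map⁺ p xs↭zs)))
    (Homogeneous.refl (pointwise zs ys gys≡fzs))
  where
  pointwise : ∀ zs ys → map g ys ≡ map f zs → Pointwise R (map p zs) (map q ys)
  pointwise []       []       eq = []
  pointwise (z ∷ zs) (y ∷ ys) eq =
    fg⇒R z y (sym (proj₁ (∷-injective eq))) ∷
    pointwise zs ys (proj₂ (∷-injective eq))

𝟙 : Bool → ℕ
𝟙 b = if b then 1 else 0

sum-filterᵇ : ∀ {A : Set} (p : A → Bool) (f : A → ℕ) {n} (g : Fin n → A) →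
              sum (map f (filterᵇ p (List.tabulate g))) ≡
              sum (List.tabulate (λ i → if p (g i) then f (g i) else 0))
sum-filterᵇ p f {zero}  g = refl
sum-filterᵇ p f {suc n} g with p (g zero)
... | true  = cong (f (g zero) +_) (sum-filterᵇ p f (g ∘ suc))
... | false = sum-filterᵇ p f (g ∘ suc)

sum-if-0 : ∀ {n} (p : Fin n → Bool) → sum (List.tabulate (λ i → if p i then 0 else 0)) ≡ 0
sum-if-0 {zero}  p = refl
sum-if-0 {suc n} p with p zero
... | true  = sum-if-0 (p ∘ suc)
... | false = sum-if-0 (p ∘ suc)

sum-δ : ∀ {n} (p : Fin n → Bool) y →
        sum (List.tabulate (λ i → if p i then 𝟙 (does (i Fin.≟ y)) else 0)) ≡ 𝟙 (p y)
sum-δ p zero    = trans (cong (𝟙 (p zero) +_) (sum-if-0 (p ∘ suc))) (ℕ.+-identityʳ (𝟙 (p zero)))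
sum-δ p (suc y) with p zero
... | true  = sum-δ (p ∘ suc) y
... | false = sum-δ (p ∘ suc) y

w-1 : ∀ G x y → w G 1 x y ≡ 𝟙 (adjacent G x y)
w-1 G x y = trans (sum-filterᵇ (adjacent G x) (λ z → w G 0 z y) (λ z → z)) (sum-δ (adjacent G x) y)

-- The two graphs and their labels.

-- For pairs with increasing entries, this is true exactly when they share one element.
meet : ℕ × ℕ → ℕ × ℕ → Bool
meet (i , j) (k , l) = ((i ≡ᵇ k) xor (j ≡ᵇ l)) xor ((i ≡ᵇ l) xor (j ≡ᵇ k))

joined : Vec (ℕ × ℕ) 28 → Fin 29 → Fin 29 → Bool
joined ps zero    zero    = false
joined ps zero    (suc y) = toℕ y <ᵇ 15
joined ps (suc x) zero    = toℕ x <ᵇ 15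
joined ps (suc x) (suc y) = meet (lookup ps x) (lookup ps y)

-- The members of S come first.  Vertices with the same index in the two graphs
-- get the same ω-colour in round 3.
pairs : Fin 2 → Vec (ℕ × ℕ) 28
pairs zero =
  (0 , 1) ∷ (0 , 2) ∷ (1 , 3) ∷ (2 , 3) ∷ (1 , 4) ∷ (1 , 5) ∷ (2 , 6) ∷ (2 , 7) ∷
  (3 , 4) ∷ (3 , 5) ∷ (4 , 6) ∷ (4 , 7) ∷ (5 , 6) ∷ (5 , 7) ∷ (6 , 7) ∷
  (0 , 3) ∷ (0 , 4) ∷ (0 , 5) ∷ (0 , 6) ∷ (0 , 7) ∷
  (1 , 2) ∷ (1 , 6) ∷ (1 , 7) ∷ (2 , 4) ∷ (2 , 5) ∷ (3 , 6) ∷ (3 , 7) ∷ (4 , 5) ∷ []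
pairs (suc zero) =
  (0 , 1) ∷ (0 , 2) ∷ (1 , 3) ∷ (2 , 3) ∷ (1 , 4) ∷ (2 , 5) ∷ (1 , 6) ∷ (2 , 7) ∷
  (3 , 4) ∷ (3 , 5) ∷ (4 , 6) ∷ (4 , 7) ∷ (5 , 6) ∷ (5 , 7) ∷ (6 , 7) ∷
  (0 , 3) ∷ (0 , 4) ∷ (0 , 5) ∷ (0 , 6) ∷ (0 , 7) ∷
  (1 , 2) ∷ (2 , 6) ∷ (1 , 7) ∷ (2 , 4) ∷ (1 , 5) ∷ (3 , 6) ∷ (3 , 7) ∷ (4 , 5) ∷ []

Γ : Fin 2 → Graph
Γ i = record
  { order     = 29
  ; adjacent  = joined (pairs i)
  ; symmetric = from-yes (all? λ i → all? λ x → all? λ y → joined (pairs i) x y Bool.≟ joined (pairs i) y x) i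
  ; loopless  = from-yes (all? λ i → all? λ x → joined (pairs i) x x Bool.≟ false) i
  }

-- The coordinates are the indicators of the pairs and of S, the number of
-- neighbours in S minus twice the indicator of S (0 at the apex), and the
-- indicator of the apex.
label : Fin 29 → Vec ℕ 4
label = lookup
  ( replicate 1  (0 ∷ 0 ∷ 0 ∷ 1 ∷ [])
 ++ replicate 2  (1 ∷ 1 ∷ 2 ∷ 0 ∷ [])
 ++ replicate 13 (1 ∷ 1 ∷ 4 ∷ 0 ∷ [])
 ++ replicate 5  (1 ∷ 0 ∷ 6 ∷ 0 ∷ [])
 ++ replicate 8  (1 ∷ 0 ∷ 8 ∷ 0 ∷ []))

-- Let `s` be the indicator of `S` and `d = A s − 2 s` on the pairs. In `K`, 4 is the coefficient of
-- `J`, the 1 in the second row counts walks through the apex, and `7 = 15 − 8` with 15 the degree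
-- of the apex. In `T`, the third row uses `A d = 8 s + 4 · 15` on the pairs, and
-- `56 = 2 · 2 + 13 · 4` sums `d` over `S`.
K T : Vec (Vec ℕ 4) 4
K = (4 ∷ 0 ∷ 0 ∷ 0 ∷ []) ∷
    (0 ∷ 1 ∷ 0 ∷ 0 ∷ []) ∷
    (0 ∷ 0 ∷ 0 ∷ 1 ∷ []) ∷
    (0 ∷ 0 ∷ 1 ∷ 7 ∷ []) ∷ []
T = (12 ∷ 0 ∷ 0 ∷ 15 ∷ []) ∷
    (0 ∷ 2 ∷ 1 ∷ 15 ∷ []) ∷
    (60 ∷ 8 ∷ 0 ∷ 56 ∷ []) ∷
    (0 ∷ 1 ∷ 0 ∷ 0 ∷ []) ∷ []

open WalkFormula 8 2 K T

label-equitable : ∀ i x → total (map label (neighbours (Γ i) x)) ≡ T ⊛ label x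
label-equitable = from-yes (all? λ i → all? λ x →
  Vec.≡-dec ℕ._≟_ (total (map label (neighbours (Γ i) x))) (T ⊛ label x))

w₂-formula : ∀ i x y → w (Γ i) 2 x y ≡
             8 * w (Γ i) 0 x y + 2 * w (Γ i) 1 x y + (K ⊛ label y) · label x
w₂-formula i x y
  rewrite w-1 (Γ i) x y
        | map-cong (λ z → w-1 (Γ i) z y) (neighbours (Γ i) x)
  = from-yes (all? λ i → all? λ x → all? λ y →
      sum (map (λ z → 𝟙 (adjacent (Γ i) z y)) (neighbours (Γ i) x)) ℕ.≟
      8 * w (Γ i) 0 x y + 2 * 𝟙 (adjacent (Γ i) x y) + (K ⊛ label y) · label x) i x y

-- Three rounds of ω.

ω-suc : ∀ {E : Set} X Y r {x x′} (f : Vertex X → E) (g : Vertex Y → E) →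
        (∀ y y′ → f y ≡ g y′ →
          w⋆ X x y ≡ w⋆ Y x′ y′ × Setoid._≈_ (ωColour r) (ω X r y) (ω Y r y′)) →
        map f (vertices X) ↭ map g (vertices Y) →
        Setoid._≈_ (ωColour r) (ω X r x) (ω Y r x′) →
        Setoid._≈_ (ωColour (suc r)) (ω X (suc r) x) (ω Y (suc r) x′)
ω-suc X Y r f g f≡g⇒ perm x≈x′ =
  x≈x′ , ↭-map (refl , Setoid.refl (ωColour r)) f≡g⇒ (vertices X) (vertices Y) perm

w⋆-cong : ∀ i j x x′ y y′ →
          w (Γ i) 0 x y ≡ w (Γ j) 0 x′ y′ →
          𝟙 (adjacent (Γ i) x y) ≡ 𝟙 (adjacent (Γ j) x′ y′) →
          label x ≡ label x′ → label y ≡ label y′ →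
          w⋆ (Γ i) x y ≡ w⋆ (Γ j) x′ y′
w⋆-cong i j x x′ y y′ δ≡ a≡ lx≡ ly≡ = map-cong same (upTo 29)
  where
  open ≡-Reasoning
  formula : ∀ i k x y → w (Γ i) k x y ≡
            walks (w (Γ i) 0 x y) (w (Γ i) 1 x y) (label y) (label x) k
  formula i = w-formula (Γ i) label (w₂-formula i) (label-equitable i)

  same : ∀ k → w (Γ i) k x y ≡ w (Γ j) k x′ y′
  same k = begin
    w (Γ i) k x y
      ≡⟨ formula i k x y ⟩
    walks (w (Γ i) 0 x y) (w (Γ i) 1 x y) (label y) (label x) k
      ≡⟨ cong₂ (λ l l′ → walks (w (Γ i) 0 x y) (w (Γ i) 1 x y) l l′ k) ly≡ lx≡ ⟩
    walks (w (Γ i) 0 x y) (w (Γ i) 1 x y) (label y′) (label x′) k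
      ≡⟨ cong₂ (λ p q → walks p q (label y′) (label x′) k) δ≡
               (trans (w-1 (Γ i) x y) (trans a≡ (sym (w-1 (Γ j) x′ y′)))) ⟩
    walks (w (Γ j) 0 x′ y′) (w (Γ j) 1 x′ y′) (label y′) (label x′) k
      ≡⟨ formula j k x′ y′ ⟨
    w (Γ j) k x′ y′ ∎

blockStart : List (Fin 29) → Fin 29 → Fin 29
blockStart starts x = foldl (λ b s → if does (s ≤? x) then s else b) zero starts

-- For r ≤ 2, ρ r sends a vertex to the first vertex with its ω-colour of round
-- r, the colour classes being intervals of indices.
ρ : ℕ → Fin 29 → Fin 29
ρ 0 = blockStart (# 1 ∷ # 3 ∷ # 16 ∷ # 21 ∷ [])
ρ 1 = blockStart (# 1 ∷ # 3 ∷ # 9 ∷ # 16 ∷ # 21 ∷ # 22 ∷ # 26 ∷ [])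
ρ 2 = blockStart (# 1 ∷ # 3 ∷ # 5 ∷ # 9 ∷ # 11 ∷ # 16 ∷ # 17 ∷ # 21 ∷ # 22 ∷ # 26 ∷ # 28 ∷ [])
ρ _ = λ x → x

-- Given the label of `x`, this fixes `w⋆ (Γ i) x y`, because `ρ r` preserves labels, and the colour
-- of `y` in round `r` once `Represents r` holds.
key : ℕ → Fin 2 → Fin 29 → Fin 29 → ℕ × ℕ × ℕ
key r i x y = w (Γ i) 0 x y , 𝟙 (adjacent (Γ i) x y) , toℕ (ρ r y)

keyOrder : DecTotalOrder 0ℓ 0ℓ 0ℓ
keyOrder = ×-decTotalOrder ℕ.≤-decTotalOrder (×-decTotalOrder ℕ.≤-decTotalOrder ℕ.≤-decTotalOrder)

keys : ℕ → Fin 2 → Fin 29 → List (ℕ × ℕ × ℕ)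
keys r i x = map (key r i x) (allFin 29)

-- Sorting makes equality of multisets decidable by evaluation. Representatives in `Γ zero` serve
-- both graphs at once.
keys-ρ : ∀ (r : Fin 3) i x → sort keyOrder (keys (toℕ r) i x) ≡
                             sort keyOrder (keys (toℕ r) zero (ρ (suc (toℕ r)) x))
keys-ρ = from-yes (all? λ (r : Fin 3) → all? λ i → all? λ x →
  ≡-dec (Product.≡-dec ℕ._≟_ (Product.≡-dec ℕ._≟_ ℕ._≟_))
    (sort keyOrder (keys (toℕ r) i x))
    (sort keyOrder (keys (toℕ r) zero (ρ (suc (toℕ r)) x))))

label-ρ : ∀ r x → label (ρ r x) ≡ label x
label-ρ 0 = from-yes (all? λ x → Vec.≡-dec ℕ._≟_ (label (ρ 0 x)) (label x))
label-ρ 1 = from-yes (all? λ x → Vec.≡-dec ℕ._≟_ (label (ρ 1 x)) (label x))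
label-ρ 2 = from-yes (all? λ x → Vec.≡-dec ℕ._≟_ (label (ρ 2 x)) (label x))
label-ρ (suc (suc (suc _))) x = refl

-- Supplies the first component of the colour of round `r + 1`, which is the colour of round `r`.
ρ-ρ : ∀ (r : Fin 3) x → ρ (toℕ r) (ρ (suc (toℕ r)) x) ≡ ρ (toℕ r) x
ρ-ρ = from-yes (all? λ (r : Fin 3) → all? λ x → ρ (toℕ r) (ρ (suc (toℕ r)) x) Fin.≟ ρ (toℕ r) x)

record Represents (r : ℕ) : Set where
  constructor represents
  field
    colour : ∀ i x → Setoid._≈_ (ωColour r) (ω (Γ i) r x) (ω (Γ zero) r (ρ r x))

open Represents

ρ₀-represents : Represents 0
ρ₀-represents = represents λ i x → w⋆-cong i zero x (ρ 0 x) x (ρ 0 x)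
  (from-yes (all? λ i → all? λ x → w (Γ i) 0 x x ℕ.≟ w (Γ zero) 0 (ρ 0 x) (ρ 0 x)) i x)
  (cong 𝟙 (trans (Graph.loopless (Γ i) x) (sym (Graph.loopless (Γ zero) (ρ 0 x)))))
  (sym (label-ρ zero x)) (sym (label-ρ zero x))

ρ-suc-represents : ∀ (r : Fin 3) → Represents (toℕ r) → Represents (suc (toℕ r))
ρ-suc-represents r′ rep = represents λ i x →
  ω-suc (Γ i) (Γ zero) r (key r i x) (key r zero (x′ x)) (key≡⇒ i x) (keys↭ i x) (x≈x′ i x)
  where
  r = toℕ r′
  x′ = ρ (suc r)
  module S = Setoid (ωColour r)

  x≈x′ : ∀ i x → ω (Γ i) r x S.≈ ω (Γ zero) r (x′ x)
  x≈x′ i x = S.trans (colour rep i x)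
        (S.trans (S.reflexive (cong (ω (Γ zero) r) (sym (ρ-ρ r′ x)))) (S.sym (colour rep zero (x′ x))))

  keys↭ : ∀ i x → keys r i x ↭ keys r zero (x′ x)
  keys↭ i x = ↭-trans (↭-sym (sort-↭ keyOrder _))
             (↭-trans (↭-reflexive (keys-ρ r′ i x)) (sort-↭ keyOrder _))

  key≡⇒ : ∀ i x y y′ → key r i x y ≡ key r zero (x′ x) y′ →
          w⋆ (Γ i) x y ≡ w⋆ (Γ zero) (x′ x) y′ × ω (Γ i) r y S.≈ ω (Γ zero) r y′
  key≡⇒ i x y y′ eq =
    w⋆-cong i zero x (x′ x) y y′ (cong proj₁ eq) (cong (proj₁ ∘ proj₂) eq)
      (sym (label-ρ (suc r) x))
      (trans (sym (label-ρ r y)) (trans (cong label ρy≡ρy′) (label-ρ r y′))) ,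
    S.trans (colour rep i y) (S.trans (S.reflexive (cong (ω (Γ zero) r) ρy≡ρy′)) (S.sym (colour rep zero y′)))
    where
    ρy≡ρy′ : ρ r y ≡ ρ r y′
    ρy≡ρy′ = toℕ-injective (cong (proj₂ ∘ proj₂) eq)

ρ₃-represents : Represents 3
ρ₃-represents = ρ-suc-represents (# 2) (ρ-suc-represents (# 1) (ρ-suc-represents (# 0) ρ₀-represents))

Permutation-map : ∀ {A B : Set} {R : B → B → Set} (f g : A → B) → (∀ x → R (f x) (g x)) →
                  ∀ xs → Permutation R (map f xs) (map g xs)
Permutation-map f g fRg xs = Homogeneous.refl (pointwise xs)
  where
  pointwise : ∀ xs → Pointwise _ (map f xs) (map g xs)
  pointwise []       = []
  pointwise (x ∷ xs) = fRg x ∷ pointwise xs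

-- `ρ 3` is the identity, so vertices of equal index are matched.
Γ-≈ω⟨3⟩ : Γ zero ≈ω⟨ 3 ⟩ Γ (suc zero)
Γ-≈ω⟨3⟩ = Permutation-map (ω (Γ zero) 3) (ω (Γ (suc zero)) 3)
  (λ x → Setoid.sym (ωColour 3) (colour ρ₃-represents (suc zero) x)) (allFin 29)

-- Separation by colour refinement.

-- χ (t ∷ ts) is the indicator of the colours of vertices with exactly t
-- neighbours for which χ ts is 1.
χ : List ℕ → Colour → ℕ
χ []       c             = 1
χ (t ∷ ts) uniform       = 0
χ (t ∷ ts) (refine _ cs) = 𝟙 (sum (map (χ ts) cs) ≡ᵇ t)

sum-Permutation : ∀ {A : Set} {R : A → A → Set} (f : A → ℕ) → (∀ {x y} → R x y → f x ≡ f y) →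
                  ∀ {xs ys} → Permutation R xs ys → sum (map f xs) ≡ sum (map f ys)
sum-Permutation f f-resp (Homogeneous.refl rs) = pointwise rs
  where
  pointwise : ∀ {xs ys} → Pointwise _ xs ys → sum (map f xs) ≡ sum (map f ys)
  pointwise []       = refl
  pointwise (r ∷ rs) = cong₂ _+_ (f-resp r) (pointwise rs)
sum-Permutation f f-resp (Homogeneous.prep r p) = cong₂ _+_ (f-resp r) (sum-Permutation f f-resp p)
sum-Permutation f f-resp (Homogeneous.swap {xs} {x = x} {y} r s p) =
  trans (swap-+ (f x) (f y) (sum (map f xs)))
        (cong₂ _+_ (f-resp s) (cong₂ _+_ (f-resp r) (sum-Permutation f f-resp p)))
  where
  swap-+ : ∀ a b c → a + (b + c) ≡ b + (a + c)
  swap-+ = solve-∀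
sum-Permutation f f-resp (Homogeneous.trans p q) =
  trans (sum-Permutation f f-resp p) (sum-Permutation f f-resp q)

-- Induction on `ts`, not on the derivation, so the hypothesis covers all entries of the nested
-- permutation.
χ-resp-≈ᶜ : ∀ ts {c d} → c ≈ᶜ d → χ ts c ≡ χ ts d
χ-resp-≈ᶜ []       c≈d           = refl
χ-resp-≈ᶜ (t ∷ ts) uniform       = refl
χ-resp-≈ᶜ (t ∷ ts) (refine _ ps) = cong (λ s → 𝟙 (s ≡ᵇ t)) (sum-Permutation (χ ts) (χ-resp-≈ᶜ ts) ps)

sum-χ-resp-≈WL₁ : ∀ ts G H → G ≈WL₁ H → sum (map (χ ts) (WL₁ G)) ≡ sum (map (χ ts) (WL₁ H))
sum-χ-resp-≈WL₁ ts G H = sum-Permutation (χ ts) (χ-resp-≈ᶜ ts)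

-- Tabulating each level avoids unfolding the nested colours; `next` takes the table as an argument
-- so that it is shared.
χ-table : (G : Graph) → List ℕ → Vec ℕ (order G)
χ-table G []       = replicate _ 1
χ-table G (t ∷ ts) = next (χ-table G ts)
  where
  next : Vec ℕ (order G) → Vec ℕ (order G)
  next v = tabulate (λ x → 𝟙 (sum (map (lookup v) (neighbours G x)) ≡ᵇ t))

-- Each threshold strips one `refine`, so `uniform` is not met before `ts` is exhausted.
χ-C : ∀ G ts k x → χ ts (C G (length ts + k) x) ≡ lookup (χ-table G ts) x
χ-C G []       k x = sym (Vec.lookup-replicate x 1)
χ-C G (t ∷ ts) k x = begin
  𝟙 (sum (map (χ ts) (map (C G (length ts + k)) N)) ≡ᵇ t)
    ≡⟨ cong (λ cs → 𝟙 (sum cs ≡ᵇ t)) (trans (sym (map-∘ N)) (map-cong (χ-C G ts k) N)) ⟩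
  𝟙 (sum (map (lookup (χ-table G ts)) N) ≡ᵇ t)
    ≡⟨ Vec.lookup∘tabulate _ x ⟨
  lookup (χ-table G (t ∷ ts)) x ∎
  where
  open ≡-Reasoning
  N = neighbours G x

sum-χ-WL₁ : ∀ G ts k → length ts + k ≡ order G →
            sum (map (χ ts) (WL₁ G)) ≡ sum (map (lookup (χ-table G ts)) (vertices G))
sum-χ-WL₁ G ts k eq = cong sum (trans (sym (map-∘ (vertices G))) (map-cong χ-order (vertices G)))
  where
  χ-order : ∀ x → χ ts (C G (order G) x) ≡ lookup (χ-table G ts) x
  χ-order x = subst (λ r → χ ts (C G r x) ≡ lookup (χ-table G ts) x) eq (χ-C G ts k x)

-- Found by search: exactly one vertex of Γ zero and none of Γ (suc zero) has χ = 1.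
thresholds : List ℕ
thresholds = 7 ∷ 4 ∷ 6 ∷ 8 ∷ 6 ∷ 12 ∷ []

tableCount : Fin 2 → ℕ
tableCount i = sum (map (lookup (χ-table (Γ i) thresholds)) (allFin 29))

sum-χ-tableCount : ∀ i → sum (map (χ thresholds) (WL₁ (Γ i))) ≡ tableCount i
-- `23 = 29 − 6`: of the 29 rounds, the six thresholds read the outermost six.
sum-χ-tableCount i = sum-χ-WL₁ (Γ i) thresholds 23 refl

tableCount-≢ : tableCount zero ≢ tableCount (suc zero)
tableCount-≢ = from-no (tableCount zero ℕ.≟ tableCount (suc zero))

Γ-≉WL₁ : ¬ (Γ zero ≈WL₁ Γ (suc zero))
Γ-≉WL₁ eq = tableCount-≢ (trans (sym (sum-χ-tableCount zero))
  (trans (sum-χ-resp-≈WL₁ thresholds (Γ zero) (Γ (suc zero)) eq) (sum-χ-tableCount (suc zero))))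

theorem6p7 : Σ[ G ∈ Graph ] Σ[ H ∈ Graph ] (G ≈ω⟨ 3 ⟩ H) × (¬ (G ≈WL₁ H))
theorem6p7 = Γ zero , Γ (suc zero) , Γ-≈ω⟨3⟩ , Γ-≉WL₁
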